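{- Let $F$ be a one-dimensional tropical fan in $\mathbb{R}^n$ whose rays span $\mathbb{R}^n$, let $v_i,v_j$ be primitive generators of two rays of $F$, and let $l,h\in(\mathbb{Z}^n)^\vee$ be such that $g_l(v_i,v_j)=g_h(v_i,v_j)$ is a gallery of $F$ (i.e. $g_l(v_i,v_j)\in\mathrm{Gly}(F)$ and $g_h(v_i,v_j)\in\mathrm{Gly}(F)$). Then $l=h$.
   Context: A one-dimensional tropical fan $F$ in $\mathbb{R}^n$ consists of finitely many distinct rays $\mathbb{R}_+v_1,\dots,\mathbb{R}_+v_q$ (and the origin), with $v_i\in\mathbb{Z}^n$ primitive, together with positive integer weights $\omega_1,\dots,\omega_q$ satisfying the balancing condition $\sum_i\omega_iv_i=0$. For $l\in(\mathbb{Z}^n)^\vee$ put $\max(0,l)\cdot F=\sum_i\omega_i\max(0,l(v_i))$. If this equals $1$, the gallery of $F$ over $\max(0,l)$ is the set of rays $\mathbb{R}_+v_i$ of $F$ with $|l(v_i)|=1$. $\mathrm{Gly}(F)$ is the set of all galleries of $F$. The notation $g_l(v_a,v_b)\in\mathrm{Gly}(F)$ means that $\max(0,l)\cdot F=1$, that the gallery over $\max(0,l)$ is $\{\mathbb{R}_+v_a,\mathbb{R}_+v_b\}$, and that $l(v_a)=1$, $l(v_b)=-1$; equivalently, $l(v_a)=1$, $l(v_b)=-1$, $\omega_a=\omega_b=1$ and $l(v_i)=0$ for all $i\ne a,b$. -}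

module Defs where

open import Algebra.Bundles using (AbelianGroup)
open import Algebra.Bundles.Raw using (RawMonoid)
import Algebra.Construct.Pointwise as Pointwise
import Algebra.Definitions.RawMonoid as RawMonoidDefs
open import Algebra.Morphism.Structures using (module GroupMorphisms)
open import Data.Fin.Base using (Fin)
open import Data.Integer.Base as ℤ using (ℤ; +_; 0ℤ; 1ℤ; -1ℤ)
import Data.Integer.Divisibility as ℤ
import Data.Integer.Properties as ℤ
open import Data.Nat.Base as ℕ using (ℕ)
import Data.Nat.Properties as ℕ
open import Data.Product.Base using (∃; _×_; _,_; proj₁; proj₂)
open import Data.Rational.Base as ℚ using (ℚ; 0ℚ; 1ℚ; ½; ∣_∣; 1/_)
import Data.Rational.Properties as ℚ
open import Data.Rational.Solver using (module +-*-Solver)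
open import Data.Vec.Functional using (Vector)
open import Function.Base using (_∘_)
open import Function.Definitions using (Injective)
open import Level using (0ℓ)
open import Relation.Binary.PropositionalEquality using (_≡_; refl; sym; trans; cong; subst)
open import Relation.Unary using (Pred; _≐_; _∪_; ｛_｝)

-- Real numbers as Cauchy sequences of rationals, with equality and order
-- defined up to null sequences and arithmetic performed termwise.

Cauchy : (ℕ → ℚ) → Set
Cauchy x = ∀ ε → 0ℚ ℚ.< ε →
  ∃ λ N → ∀ m n → N ℕ.≤ m → N ℕ.≤ n → ∣ x m ℚ.- x n ∣ ℚ.< ε

record ℝ : Set where
  constructor mkℝ
  field
    seq    : ℕ → ℚ
    cauchy : Cauchy seq

open ℝ public

infix 4 _≃_ _≤ℝ_

_≃_ : ℝ → ℝ → Set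
x ≃ y = ∀ ε → 0ℚ ℚ.< ε →
  ∃ λ N → ∀ n → N ℕ.≤ n → ∣ seq x n ℚ.- seq y n ∣ ℚ.< ε

_≤ℝ_ : ℝ → ℝ → Set
x ≤ℝ y = ∀ ε → 0ℚ ℚ.< ε →
  ∃ λ N → ∀ n → N ℕ.≤ n → seq x n ℚ.< seq y n ℚ.+ ε

private

  const-cauchy : ∀ p → Cauchy (λ _ → p)
  const-cauchy p ε 0<ε = 0 , λ _ _ _ _ →
    subst (λ d → ∣ d ∣ ℚ.< ε) (sym (ℚ.+-inverseʳ p)) 0<ε

  +-cauchy : ∀ {x y} → Cauchy x → Cauchy y → Cauchy (λ n → x n ℚ.+ y n)
  +-cauchy {x} {y} cx cy ε 0<ε = N , bound
    where
    instance _ = ℚ.positive 0<ε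
    η : ℚ
    η = ε ℚ.* ½
    0<η : 0ℚ ℚ.< η
    0<η = ℚ.positive⁻¹ η {{ℚ.pos*pos⇒pos ε ½}}
    N = proj₁ (cx η 0<η) ℕ.⊔ proj₁ (cy η 0<η)
    η+η≡ε : η ℚ.+ η ≡ ε
    η+η≡ε = trans (sym (ℚ.*-distribˡ-+ ε ½ ½)) (ℚ.*-identityʳ ε)
    bound : ∀ m n → N ℕ.≤ m → N ℕ.≤ n →
            ∣ (x m ℚ.+ y m) ℚ.- (x n ℚ.+ y n) ∣ ℚ.< ε
    bound m n N≤m N≤n = begin-strict
      ∣ (x m ℚ.+ y m) ℚ.- (x n ℚ.+ y n) ∣
        ≡⟨ cong ∣_∣ (solve 4 (λ a b c d → (a :+ b) :- (c :+ d) := (a :- c) :+ (b :- d))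
                     refl (x m) (y m) (x n) (y n)) ⟩
      ∣ (x m ℚ.- x n) ℚ.+ (y m ℚ.- y n) ∣
        ≤⟨ ℚ.∣p+q∣≤∣p∣+∣q∣ (x m ℚ.- x n) (y m ℚ.- y n) ⟩
      ∣ x m ℚ.- x n ∣ ℚ.+ ∣ y m ℚ.- y n ∣
        <⟨ ℚ.+-mono-<
             (proj₂ (cx η 0<η) m n (ℕ.m⊔n≤o⇒m≤o _ _ N≤m) (ℕ.m⊔n≤o⇒m≤o _ _ N≤n))
             (proj₂ (cy η 0<η) m n (ℕ.m⊔n≤o⇒n≤o _ _ N≤m) (ℕ.m⊔n≤o⇒n≤o _ _ N≤n)) ⟩
      η ℚ.+ η
        ≡⟨ η+η≡ε ⟩
      ε ∎
      where
      open ℚ.≤-Reasoning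
      open +-*-Solver

  cauchy-bounded : ∀ {x} → Cauchy x →
    ∃ λ B → 0ℚ ℚ.< B × ∃ λ N → ∀ n → N ℕ.≤ n → ∣ x n ∣ ℚ.≤ B
  cauchy-bounded {x} cx = 1ℚ ℚ.+ ∣ x N ∣ , 0<B , N , bound
    where
    0<1 : 0ℚ ℚ.< 1ℚ
    0<1 = ℚ.positive⁻¹ 1ℚ
    N = proj₁ (cx 1ℚ 0<1)
    0<B : 0ℚ ℚ.< 1ℚ ℚ.+ ∣ x N ∣
    0<B = ℚ.+-mono-<-≤ 0<1 (ℚ.0≤∣p∣ (x N))
    bound : ∀ n → N ℕ.≤ n → ∣ x n ∣ ℚ.≤ 1ℚ ℚ.+ ∣ x N ∣
    bound n N≤n = begin
      ∣ x n ∣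
        ≡⟨ cong ∣_∣ (solve 2 (λ a b → a := (a :- b) :+ b) refl (x n) (x N)) ⟩
      ∣ (x n ℚ.- x N) ℚ.+ x N ∣
        ≤⟨ ℚ.∣p+q∣≤∣p∣+∣q∣ (x n ℚ.- x N) (x N) ⟩
      ∣ x n ℚ.- x N ∣ ℚ.+ ∣ x N ∣
        ≤⟨ ℚ.+-monoˡ-≤ ∣ x N ∣ (ℚ.<⇒≤ (proj₂ (cx 1ℚ 0<1) n N N≤n ℕ.≤-refl)) ⟩
      1ℚ ℚ.+ ∣ x N ∣ ∎
      where
      open ℚ.≤-Reasoning
      open +-*-Solver

  *-bound : ∀ {B δ} p q → 0ℚ ℚ.< B → ∣ p ∣ ℚ.≤ B → ∣ q ∣ ℚ.< δ →
            ∣ p ℚ.* q ∣ ℚ.< B ℚ.* δ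
  *-bound {B} {δ} p q 0<B p≤B q<δ = begin-strict
    ∣ p ℚ.* q ∣        ≡⟨ ℚ.∣p*q∣≡∣p∣*∣q∣ p q ⟩
    ∣ p ∣ ℚ.* ∣ q ∣    ≤⟨ ℚ.*-monoʳ-≤-nonNeg ∣ q ∣ {{ℚ.nonNegative (ℚ.0≤∣p∣ q)}} p≤B ⟩
    B ℚ.* ∣ q ∣        <⟨ ℚ.*-monoʳ-<-pos B {{ℚ.positive 0<B}} q<δ ⟩
    B ℚ.* δ            ∎
    where open ℚ.≤-Reasoning

  split-* : ∀ a b c d → a ℚ.* b ℚ.- c ℚ.* d ≡ a ℚ.* (b ℚ.- d) ℚ.+ d ℚ.* (a ℚ.- c)
  split-* = solve 4 (λ a b c d → a :* b :- c :* d := a :* (b :- d) :+ d :* (a :- c)) refl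
    where open +-*-Solver

  divide : ∀ K ε → 0ℚ ℚ.< K → 0ℚ ℚ.< ε → ∃ λ δ → 0ℚ ℚ.< δ × K ℚ.* δ ≡ ε
  divide K ε 0<K 0<ε = 1/ K ℚ.* ε
    , ℚ.positive⁻¹ _ {{ℚ.pos*pos⇒pos (1/ K) {{ℚ.1/pos⇒pos K}} ε}}
    , trans (sym (ℚ.*-assoc K (1/ K) ε))
      (trans (cong (ℚ._* ε) (ℚ.*-inverseʳ K)) (ℚ.*-identityˡ ε))
    where
    instance
      ε-pos : ℚ.Positive ε
      ε-pos = ℚ.positive 0<ε
      K-pos : ℚ.Positive K
      K-pos = ℚ.positive 0<K
      K-nonZero : ℚ.NonZero K
      K-nonZero = ℚ.pos⇒nonZero K

  *-close : ∀ {B C δ ε} a b c d → 0ℚ ℚ.< B → 0ℚ ℚ.< C → (B ℚ.+ C) ℚ.* δ ≡ ε →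
            ∣ a ∣ ℚ.≤ B → ∣ d ∣ ℚ.≤ C → ∣ a ℚ.- c ∣ ℚ.< δ → ∣ b ℚ.- d ∣ ℚ.< δ →
            ∣ a ℚ.* b ℚ.- c ℚ.* d ∣ ℚ.< ε
  *-close {B} {C} {δ} {ε} a b c d 0<B 0<C Kδ≡ε a≤B d≤C ac<δ bd<δ = begin-strict
    ∣ a ℚ.* b ℚ.- c ℚ.* d ∣
      ≡⟨ cong ∣_∣ (split-* a b c d) ⟩
    ∣ a ℚ.* (b ℚ.- d) ℚ.+ d ℚ.* (a ℚ.- c) ∣
      ≤⟨ ℚ.∣p+q∣≤∣p∣+∣q∣ (a ℚ.* (b ℚ.- d)) (d ℚ.* (a ℚ.- c)) ⟩
    ∣ a ℚ.* (b ℚ.- d) ∣ ℚ.+ ∣ d ℚ.* (a ℚ.- c) ∣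
      <⟨ ℚ.+-mono-< (*-bound a (b ℚ.- d) 0<B a≤B bd<δ) (*-bound d (a ℚ.- c) 0<C d≤C ac<δ) ⟩
    B ℚ.* δ ℚ.+ C ℚ.* δ
      ≡⟨ ℚ.*-distribʳ-+ δ B C ⟨
    (B ℚ.+ C) ℚ.* δ
      ≡⟨ Kδ≡ε ⟩
    ε ∎
    where open ℚ.≤-Reasoning

  *-cauchy : ∀ {x y} → Cauchy x → Cauchy y → Cauchy (λ n → x n ℚ.* y n)
  *-cauchy {x} {y} cx cy ε 0<ε =
    let B , 0<B , Nx , bx = cauchy-bounded {x} cx
        C , 0<C , Ny , by = cauchy-bounded {y} cy
        δ , 0<δ , Kδ≡ε    = divide (B ℚ.+ C) ε (ℚ.+-mono-< 0<B 0<C) 0<ε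
        M , cx′           = cx δ 0<δ
        N , cy′           = cy δ 0<δ
    in (M ℕ.⊔ N) ℕ.⊔ (Nx ℕ.⊔ Ny) , λ m n ≤m ≤n →
      *-close (x m) (y m) (x n) (y n) 0<B 0<C Kδ≡ε
        (bx m (ℕ.m⊔n≤o⇒m≤o Nx Ny (ℕ.m⊔n≤o⇒n≤o (M ℕ.⊔ N) (Nx ℕ.⊔ Ny) ≤m)))
        (by n (ℕ.m⊔n≤o⇒n≤o Nx Ny (ℕ.m⊔n≤o⇒n≤o (M ℕ.⊔ N) (Nx ℕ.⊔ Ny) ≤n)))
        (cx′ m n (ℕ.m⊔n≤o⇒m≤o M N (ℕ.m⊔n≤o⇒m≤o (M ℕ.⊔ N) (Nx ℕ.⊔ Ny) ≤m))
                 (ℕ.m⊔n≤o⇒m≤o M N (ℕ.m⊔n≤o⇒m≤o (M ℕ.⊔ N) (Nx ℕ.⊔ Ny) ≤n)))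
        (cy′ m n (ℕ.m⊔n≤o⇒n≤o M N (ℕ.m⊔n≤o⇒m≤o (M ℕ.⊔ N) (Nx ℕ.⊔ Ny) ≤m))
                 (ℕ.m⊔n≤o⇒n≤o M N (ℕ.m⊔n≤o⇒m≤o (M ℕ.⊔ N) (Nx ℕ.⊔ Ny) ≤n)))

fromℚ : ℚ → ℝ
fromℚ p = mkℝ (λ _ → p) (const-cauchy p)

fromℤ : ℤ → ℝ
fromℤ k = fromℚ (k ℚ./ 1)

0ℝ : ℝ
0ℝ = fromℚ 0ℚ

infixl 6 _+ℝ_
infixl 7 _*ℝ_

_+ℝ_ : ℝ → ℝ → ℝ
x +ℝ y = mkℝ (λ n → seq x n ℚ.+ seq y n) (+-cauchy {seq x} {seq y} (cauchy x) (cauchy y))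

_*ℝ_ : ℝ → ℝ → ℝ
x *ℝ y = mkℝ (λ n → seq x n ℚ.* seq y n) (*-cauchy {seq x} {seq y} (cauchy x) (cauchy y))

+ℝ-0-rawMonoid : RawMonoid 0ℓ 0ℓ
+ℝ-0-rawMonoid = record { Carrier = ℝ ; _≈_ = _≃_ ; _∙_ = _+ℝ_ ; ε = 0ℝ }

open RawMonoidDefs +ℝ-0-rawMonoid public using () renaming (sum to ∑ℝ)
open RawMonoidDefs ℤ.+-0-rawMonoid public using () renaming (sum to ∑ℤ)

ℤ^_ : ℕ → AbelianGroup 0ℓ 0ℓ
ℤ^ n = Pointwise.abelianGroup (Fin n) ℤ.+-0-abelianGroup

-- (ℤⁿ)^∨: additive functionals on ℤⁿ.  Vectors are functions, so the
-- homomorphism condition includes respecting pointwise equality.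
record Dual (n : ℕ) : Set where
  field
    ⟦_⟧  : Vector ℤ n → ℤ
    homo : GroupMorphisms.IsGroupHomomorphism
             (AbelianGroup.rawGroup (ℤ^ n)) ℤ.+-0-rawGroup ⟦_⟧

open Dual public using (⟦_⟧)

infix 4 _≈ᵈ_

_≈ᵈ_ : ∀ {n} → Dual n → Dual n → Set
l ≈ᵈ h = ∀ x → ⟦ l ⟧ x ≡ ⟦ h ⟧ x

-- The coordinates have greatest common divisor 1; this excludes v = 0.
Primitive : ∀ {n} → Vector ℤ n → Set
Primitive v = ∀ (d : ℕ) → (∀ k → + d ℤ.∣ v k) → d ≡ 1

-- ℝ₊v as a subset of ℝⁿ.
Ray : ∀ {n} → Vector ℤ n → Pred (Vector ℝ n) 0ℓ
Ray v p = ∃ λ t → 0ℝ ≤ℝ t × ∀ k → p k ≃ t *ℝ fromℤ (v k)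

-- A ray of the fan is referred to by its index in Fin q, which determines
-- and is determined by the subset Ray (v i) of ℝⁿ.
record TropicalFan (n : ℕ) : Set where
  field
    q           : ℕ
    v           : Fin q → Vector ℤ n
    ω           : Fin q → ℕ
    v-primitive : ∀ i → Primitive (v i)
    distinct    : Injective _≡_ _≐_ (Ray ∘ v)
    ω-positive  : ∀ i → 0 ℕ.< ω i
    balanced    : ∀ k → ∑ℤ (λ i → + ω i ℤ.* v i k) ≡ 0ℤ

module _ {n} (F : TropicalFan n) where

  open TropicalFan F

  -- The linear span of the union of the rays of F is ℝⁿ.
  RaysSpan : Set
  RaysSpan = ∀ (p : Vector ℝ n) → ∃ λ (c : Vector ℝ q) →
    ∀ k → p k ≃ ∑ℝ (λ i → c i *ℝ fromℤ (v i k))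

  -- max(0,l)·F
  maxDegree : Dual n → ℤ
  maxDegree l = ∑ℤ (λ i → + ω i ℤ.* (0ℤ ℤ.⊔ ⟦ l ⟧ (v i)))

  -- Only meaningful as the gallery over max(0,l) when max(0,l)·F = 1.
  gallery : Dual n → Pred (Fin q) 0ℓ
  gallery l i = ℤ.∣ ⟦ l ⟧ (v i) ∣ ≡ 1

  -- g_l(v_a,v_b) ∈ Gly(F)
  record IsGallery (l : Dual n) (a b : Fin q) : Set where
    field
      degree-one : maxDegree l ≡ 1ℤ
      rays       : gallery l ≐ ｛ a ｝ ∪ ｛ b ｝
      l[va]≡1    : ⟦ l ⟧ (v a) ≡ 1ℤ
      l[vb]≡-1   : ⟦ l ⟧ (v b) ≡ -1ℤ

{-# OPTIONS --safe #-}
-- max(0,l)·F = 1 bounds every l(v_k) above by 1, and by balancing max(0,−l)·F = 1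
-- as well, so |l(v_k)| ≤ 1; hence l vanishes on every ray outside the gallery.
-- Thus l − h vanishes on all v_k.  Spanning writes an integer vector x as a real
-- combination of the v_k, that is, as a limit of rational ones, on each of which
-- the ℚ-linear extension of l − h is zero; so (l − h)(x) is a null constant.
module Submission where

open import Defs
open import Data.Nat.Base using (ℕ)
open import Data.Fin.Base using (Fin)

open import Algebra.Bundles using (AbelianGroup; CommutativeRing; Semiring)
open import Algebra.Morphism.Structures using (module GroupMorphisms; module MagmaMorphisms)
open import Algebra.Properties.Group using (identityʳ-unique; inverseʳ-unique)
import Algebra.Properties.Semiring.Sum as SemiringSum
import Data.Fin.Base as Fin
open import Data.Integer.Base as ℤ using (ℤ; +_; -[1+_]; 0ℤ; 1ℤ; +≤+; nonNegative)
import Data.Integer.Properties as ℤ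
import Data.Integer.Solver as ℤSolver
import Data.Nat.Base as ℕ
import Data.Nat.Properties as ℕ
open import Data.Product.Base using (∃; _,_; proj₁; proj₂)
open import Data.Rational.Base as ℚ using (ℚ; 0ℚ; 1ℚ; ½; ∣_∣; 1/_; fromℚᵘ)
import Data.Rational.Properties as ℚ
import Data.Rational.Solver as ℚSolver
open import Data.Rational.Unnormalised.Base as ℚᵘ using (mkℚᵘ; *≡*)
import Data.Rational.Unnormalised.Properties as ℚᵘ
open import Data.Sum.Base using (_⊎_; inj₁; inj₂)
open import Data.Vec.Functional using (Vector; _∷_; head; tail; replicate)
open import Function.Base using (_∘_)
open import Relation.Binary.Definitions using (tri<; tri≈; tri>)
open import Relation.Binary.PropositionalEquality using (_≡_; refl; sym; trans; cong; cong₂; subst; module ≡-Reasoning)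
open import Relation.Nullary.Decidable using (yes; no)
open import Relation.Nullary.Negation using (contradiction)
open import Relation.Unary using (_∪_; ｛_｝)

-- Finite sums and linear combinations over a semiring.

module _ {c ℓ} (R : Semiring c ℓ) where

  open Semiring R
  open SemiringSum R
  open import Relation.Binary.Reasoning.Setoid setoid

  -- Interchange of two finite sums. Over ℤ it carries the balancing condition through a functional;
  -- over ℚ it passes from vanishing on each row of `M` to vanishing on every combination of rows.
  linearCombination-assoc : ∀ {q n} (c : Vector Carrier q) (M : Fin q → Vector Carrier n) (a : Vector Carrier n) →
    sum (λ m → sum (λ k → c k * M k m) * a m) ≈ sum (λ k → c k * sum (λ m → M k m * a m))
  linearCombination-assoc c M a = begin
    sum (λ m → sum (λ k → c k * M k m) * a m)
      ≈⟨ sum-cong-≋ (λ m → *-distribʳ-sum (a m) (λ k → c k * M k m)) ⟩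
    sum (λ m → sum (λ k → c k * M k m * a m))
      ≈⟨ ∑-comm (λ m k → c k * M k m * a m) ⟩
    sum (λ k → sum (λ m → c k * M k m * a m))
      ≈⟨ sum-cong-≋ (λ k → sum-cong-≋ (λ m → *-assoc (c k) (M k m) (a m))) ⟩
    sum (λ k → sum (λ m → c k * (M k m * a m)))
      ≈⟨ sum-cong-≋ (λ k → *-distribˡ-sum (c k) (λ m → M k m * a m)) ⟨
    sum (λ k → c k * sum (λ m → M k m * a m)) ∎

  sum-zero : ∀ {n} (f : Vector Carrier n) → (∀ k → f k ≈ 0#) → sum f ≈ 0#
  sum-zero {n} f f≈0 = Semiring.trans R (sum-cong-≋ f≈0) (sum-replicate-zero n)

ℤ-semiring = CommutativeRing.semiring ℤ.+-*-commutativeRing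
ℚ-semiring = CommutativeRing.semiring ℚ.+-*-commutativeRing
ℤ-group    = AbelianGroup.group ℤ.+-0-abelianGroup

module ∑ℤ = SemiringSum ℤ-semiring
module ∑ℚ = SemiringSum ℚ-semiring
open ∑ℚ using () renaming (sum to ∑ℚ)

combination-zero : ∀ {q n} (c : Vector ℚ q) (w : Fin q → Vector ℚ n) (a : Vector ℚ n) →
  (∀ k → ∑ℚ (λ m → w k m ℚ.* a m) ≡ 0ℚ) →
  ∑ℚ (λ m → ∑ℚ (λ k → c k ℚ.* w k m) ℚ.* a m) ≡ 0ℚ
combination-zero c w a w∙a≡0 = trans (linearCombination-assoc ℚ-semiring c w a)
  (sum-zero ℚ-semiring _ (λ k → trans (cong (c k ℚ.*_) (w∙a≡0 k)) (ℚ.*-zeroʳ (c k))))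

-- Real equality `≃` controls only differences of terms, so the functional is evaluated on `x - y`;
-- this removes the contribution of `y`.
subtract-zero : ∀ {n} (x y a : Vector ℚ n) → ∑ℚ (λ m → y m ℚ.* a m) ≡ 0ℚ →
  ∑ℚ (λ m → (x m ℚ.- y m) ℚ.* a m) ≡ ∑ℚ (λ m → x m ℚ.* a m)
subtract-zero x y a y∙a≡0 = begin
  ∑ℚ d
    ≡⟨ ℚ.+-identityʳ (∑ℚ d) ⟨
  ∑ℚ d ℚ.+ 0ℚ
    ≡⟨ cong (∑ℚ d ℚ.+_) y∙a≡0 ⟨
  ∑ℚ d ℚ.+ ∑ℚ (λ m → y m ℚ.* a m)
    ≡⟨ ∑ℚ.∑-distrib-+ d (λ m → y m ℚ.* a m) ⟨
  ∑ℚ (λ m → d m ℚ.+ y m ℚ.* a m)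
    ≡⟨ ∑ℚ.sum-cong-≗ (λ m → solve 3 (λ x y a → (x :- y) :* a :+ y :* a := x :* a) refl (x m) (y m) (a m)) ⟩
  ∑ℚ (λ m → x m ℚ.* a m) ∎
  where
  open ≡-Reasoning
  open ℚSolver.+-*-Solver
  d : Vector ℚ _
  d m = (x m ℚ.- y m) ℚ.* a m

-- Additive maps on ℤⁿ

IsAdditive : ∀ {n} → (Vector ℤ n → ℤ) → Set
IsAdditive {n} = MagmaMorphisms.IsMagmaHomomorphism (AbelianGroup.rawMagma (ℤ^ n)) ℤ.+-rawMagma

module _ (f : ℤ → ℤ) (f-+ : ∀ x y → f (x ℤ.+ y) ≡ f x ℤ.+ f y) where

  additive⇒0 : f 0ℤ ≡ 0ℤ
  additive⇒0 = identityʳ-unique ℤ-group (f 0ℤ) (f 0ℤ) (sym (f-+ 0ℤ 0ℤ))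

  additive⇒linear-+ : ∀ n → f (+ n) ≡ + n ℤ.* f 1ℤ
  additive⇒linear-+ ℕ.zero    = additive⇒0
  additive⇒linear-+ (ℕ.suc n) = begin
    f (+ ℕ.suc n)             ≡⟨ f-+ 1ℤ (+ n) ⟩
    f 1ℤ ℤ.+ f (+ n)          ≡⟨ cong (λ y → f 1ℤ ℤ.+ y) (additive⇒linear-+ n) ⟩
    f 1ℤ ℤ.+ + n ℤ.* f 1ℤ     ≡⟨ ℤ.suc-* (+ n) (f 1ℤ) ⟨
    + ℕ.suc n ℤ.* f 1ℤ        ∎
    where open ≡-Reasoning

  additive⇒linear : ∀ x → f x ≡ x ℤ.* f 1ℤ
  additive⇒linear (+ n)    = additive⇒linear-+ n
  additive⇒linear -[1+ n ] = begin
    f -[1+ n ]                   ≡⟨ inverseʳ-unique ℤ-group (f y) (f (ℤ.- y)) cancel ⟩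
    ℤ.- f y                      ≡⟨ cong ℤ.-_ (additive⇒linear-+ (ℕ.suc n)) ⟩
    ℤ.- (y ℤ.* f 1ℤ)             ≡⟨ ℤ.neg-distribˡ-* y (f 1ℤ) ⟩
    -[1+ n ] ℤ.* f 1ℤ            ∎
    where
    open ≡-Reasoning
    y = + ℕ.suc n
    cancel : f y ℤ.+ f (ℤ.- y) ≡ 0ℤ
    cancel = trans (sym (f-+ y (ℤ.- y))) (trans (cong f (ℤ.+-inverseʳ y)) additive⇒0)

-- Induction on the dimension, splitting off the first coordinate; `a` lists the values of `φ` on
-- the standard basis. Coordinates allow an integral functional to be evaluated on rational vectors.
additive⇒coordinates : ∀ {n} (φ : Vector ℤ n → ℤ) → IsAdditive φ →
  ∃ λ (a : Vector ℤ n) → ∀ x → φ x ≡ ∑ℤ (λ m → x m ℤ.* a m)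
additive⇒coordinates {ℕ.zero} φ φ-additive = (λ ()) , λ x →
  -- In dimension zero `x + x` and `x` agree pointwise, so `φ x + φ x = φ x`.
  identityʳ-unique ℤ-group (φ x) (φ x)
    (trans (sym (homo x x)) (⟦⟧-cong λ ()))
  where open MagmaMorphisms.IsMagmaHomomorphism φ-additive
additive⇒coordinates {ℕ.suc n} φ φ-additive = φ₀ 1ℤ ∷ proj₁ ih , λ x → begin
  φ x
    ≡⟨ ⟦⟧-cong (λ { Fin.zero → sym (ℤ.+-identityʳ (head x))
                  ; (Fin.suc m) → sym (ℤ.+-identityˡ (tail x m)) }) ⟩
  φ (λ m → (head x ∷ replicate n 0ℤ) m ℤ.+ (0ℤ ∷ tail x) m)
    ≡⟨ homo _ _ ⟩
  φ₀ (head x) ℤ.+ φ₊ (tail x)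
    ≡⟨ cong₂ ℤ._+_ (additive⇒linear φ₀ φ₀-+ (head x)) (proj₂ ih (tail x)) ⟩
  ∑ℤ (λ m → x m ℤ.* (φ₀ 1ℤ ∷ proj₁ ih) m) ∎
  where
  open ≡-Reasoning
  open MagmaMorphisms.IsMagmaHomomorphism φ-additive
  φ₀ : ℤ → ℤ
  φ₀ y = φ (y ∷ replicate n 0ℤ)
  φ₊ : Vector ℤ n → ℤ
  φ₊ y = φ (0ℤ ∷ y)
  φ₀-+ : ∀ x y → φ₀ (x ℤ.+ y) ≡ φ₀ x ℤ.+ φ₀ y
  φ₀-+ x y = trans (⟦⟧-cong λ { Fin.zero → refl ; (Fin.suc m) → refl }) (homo _ _)
  φ₊-additive : IsAdditive φ₊
  φ₊-additive = record
    { isRelHomomorphism = record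
      { cong = λ x≈y → ⟦⟧-cong λ { Fin.zero → refl ; (Fin.suc m) → x≈y m } }
    ; homo = λ x y → trans (⟦⟧-cong λ { Fin.zero → refl ; (Fin.suc m) → refl }) (homo _ _)
    }
  ih = additive⇒coordinates φ₊ φ₊-additive

Dual-isAdditive : ∀ {n} (l : Dual n) → IsAdditive ⟦ l ⟧
Dual-isAdditive l = isMagmaHomomorphism
  where open GroupMorphisms.IsGroupHomomorphism (Dual.homo l)

difference-isAdditive : ∀ {n} {φ ψ : Vector ℤ n → ℤ} → IsAdditive φ → IsAdditive ψ →
                        IsAdditive (λ x → φ x ℤ.- ψ x)
difference-isAdditive {φ = φ} {ψ} φ-additive ψ-additive = record
  { isRelHomomorphism = record { cong = λ x≈y → cong₂ ℤ._-_ (Φ.⟦⟧-cong x≈y) (Ψ.⟦⟧-cong x≈y) }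
  ; homo = λ x y → trans (cong₂ ℤ._-_ (Φ.homo x y) (Ψ.homo x y))
      (solve 4 (λ a b c d → (a :+ b) :- (c :+ d) := (a :- c) :+ (b :- d))
         refl (φ x) (φ y) (ψ x) (ψ y))
  }
  where
  open ℤSolver.+-*-Solver
  module Φ = MagmaMorphisms.IsMagmaHomomorphism φ-additive
  module Ψ = MagmaMorphisms.IsMagmaHomomorphism ψ-additive

-- The embedding of ℤ into ℚ

ι : ℤ → ℚ
ι k = k ℚ./ 1

-- Elements of ℚ are normalised fractions, so the identity is checked after the injective map
-- `toℚᵘ`, where it holds up to equivalence of fractions.
fromℚᵘ-homo-+ : ∀ p q → fromℚᵘ (p ℚᵘ.+ q) ≡ fromℚᵘ p ℚ.+ fromℚᵘ q
fromℚᵘ-homo-+ p q = ℚ.toℚᵘ-injective (ℚᵘ.≃-trans (ℚ.toℚᵘ-fromℚᵘ (p ℚᵘ.+ q)) (ℚᵘ.≃-sym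
  (ℚᵘ.≃-trans (ℚ.toℚᵘ-homo-+ (fromℚᵘ p) (fromℚᵘ q))
    (ℚᵘ.+-cong (ℚ.toℚᵘ-fromℚᵘ p) (ℚ.toℚᵘ-fromℚᵘ q)))))

fromℚᵘ-homo-* : ∀ p q → fromℚᵘ (p ℚᵘ.* q) ≡ fromℚᵘ p ℚ.* fromℚᵘ q
fromℚᵘ-homo-* p q = ℚ.toℚᵘ-injective (ℚᵘ.≃-trans (ℚ.toℚᵘ-fromℚᵘ (p ℚᵘ.* q)) (ℚᵘ.≃-sym
  (ℚᵘ.≃-trans (ℚ.toℚᵘ-homo-* (fromℚᵘ p) (fromℚᵘ q))
    (ℚᵘ.*-cong (ℚ.toℚᵘ-fromℚᵘ p) (ℚ.toℚᵘ-fromℚᵘ q)))))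

ι-+ : ∀ x y → ι (x ℤ.+ y) ≡ ι x ℚ.+ ι y
ι-+ x y = trans
  -- The unnormalised sum has numerator `x * 1 + y * 1`, so it is first matched with `x + y` as an
  -- equivalent fraction.
  (ℚ.fromℚᵘ-cong {mkℚᵘ (x ℤ.+ y) 0} {mkℚᵘ x 0 ℚᵘ.+ mkℚᵘ y 0}
    (*≡* (solve 2 (λ a b → (a :+ b) :* con 1ℤ := (a :* con 1ℤ :+ b :* con 1ℤ) :* con 1ℤ) refl x y)))
  (fromℚᵘ-homo-+ (mkℚᵘ x 0) (mkℚᵘ y 0))
  where open ℤSolver.+-*-Solver

ι-* : ∀ x y → ι (x ℤ.* y) ≡ ι x ℚ.* ι y
ι-* x y = fromℚᵘ-homo-* (mkℚᵘ x 0) (mkℚᵘ y 0)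

ι-injective : ∀ {x y} → ι x ≡ ι y → x ≡ y
ι-injective {x} {y} eq with ℚ.fromℚᵘ-injective {mkℚᵘ x 0} {mkℚᵘ y 0} eq
... | *≡* x*1≡y*1 = ℤ.*-cancelʳ-≡ x y 1ℤ x*1≡y*1

ι-∑ : ∀ {n} (x a : Vector ℤ n) → ι (∑ℤ (λ m → x m ℤ.* a m)) ≡ ∑ℚ (λ m → ι (x m) ℚ.* ι (a m))
ι-∑ {ℕ.zero}  x a = refl
ι-∑ {ℕ.suc n} x a = trans (ι-+ (head x ℤ.* head a) _)
  (cong₂ ℚ._+_ (ι-* (head x) (head a)) (ι-∑ (tail x) (tail a)))

-- Null sequences

-- Stated so that `x ≃ y` is by definition `Null` of the termwise difference.
Null : (ℕ → ℚ) → Set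
Null x = ∀ ε → 0ℚ ℚ.< ε → ∃ λ N → ∀ n → N ℕ.≤ n → ∣ x n ∣ ℚ.< ε

Null-0 : Null (λ _ → 0ℚ)
Null-0 ε 0<ε = 0 , λ _ _ → 0<ε

Null-+ : ∀ {x y} → Null x → Null y → Null (λ n → x n ℚ.+ y n)
Null-+ {x} {y} x-null y-null ε 0<ε = M ℕ.⊔ N , λ n M⊔N≤n → begin-strict
  ∣ x n ℚ.+ y n ∣       ≤⟨ ℚ.∣p+q∣≤∣p∣+∣q∣ (x n) (y n) ⟩
  ∣ x n ∣ ℚ.+ ∣ y n ∣   <⟨ ℚ.+-mono-< (proj₂ (x-null η 0<η) n (ℕ.m⊔n≤o⇒m≤o M N M⊔N≤n))
                                      (proj₂ (y-null η 0<η) n (ℕ.m⊔n≤o⇒n≤o M N M⊔N≤n)) ⟩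
  η ℚ.+ η               ≡⟨ ℚ.*-distribˡ-+ ε ½ ½ ⟨
  ε ℚ.* 1ℚ              ≡⟨ ℚ.*-identityʳ ε ⟩
  ε                     ∎
  where
  open ℚ.≤-Reasoning
  instance _ = ℚ.positive 0<ε
  η = ε ℚ.* ½
  0<η : 0ℚ ℚ.< η
  0<η = ℚ.positive⁻¹ η {{ℚ.pos*pos⇒pos ε ½}}
  M = proj₁ (x-null η 0<η)
  N = proj₁ (y-null η 0<η)

Null-*ʳ : ∀ {x} → Null x → ∀ r → Null (λ n → x n ℚ.* r)
Null-*ʳ {x} x-null r ε 0<ε = proj₁ (x-null δ 0<δ) , λ n N≤n → begin-strict
  ∣ x n ℚ.* r ∣         ≡⟨ ℚ.∣p*q∣≡∣p∣*∣q∣ (x n) r ⟩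
  ∣ x n ∣ ℚ.* ∣ r ∣     ≤⟨ ℚ.*-monoˡ-≤-nonNeg ∣ x n ∣ {{ℚ.nonNegative (ℚ.0≤∣p∣ (x n))}} ∣r∣≤B ⟩
  ∣ x n ∣ ℚ.* B         <⟨ ℚ.*-monoˡ-<-pos B (proj₂ (x-null δ 0<δ) n N≤n) ⟩
  ε ℚ.* 1/ B ℚ.* B      ≡⟨ ℚ.*-assoc ε (1/ B) B ⟩
  ε ℚ.* (1/ B ℚ.* B)    ≡⟨ cong (ε ℚ.*_) (ℚ.*-inverseˡ B) ⟩
  ε ℚ.* 1ℚ              ≡⟨ ℚ.*-identityʳ ε ⟩
  ε                     ∎
  where
  open ℚ.≤-Reasoning
  -- Adding 1 keeps the bound positive when `r` is zero, so that `1/ B` exists.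
  B = 1ℚ ℚ.+ ∣ r ∣
  ∣r∣≤B : ∣ r ∣ ℚ.≤ B
  ∣r∣≤B = ℚ.≤-trans (ℚ.≤-reflexive (sym (ℚ.+-identityˡ ∣ r ∣)))
                    (ℚ.+-monoˡ-≤ ∣ r ∣ (ℚ.nonNegative⁻¹ 1ℚ))
  instance
    ε-pos : ℚ.Positive ε
    ε-pos = ℚ.positive 0<ε
    B-pos : ℚ.Positive B
    B-pos = ℚ.positive (ℚ.+-mono-<-≤ (ℚ.positive⁻¹ 1ℚ) (ℚ.0≤∣p∣ r))
    B-nonZero : ℚ.NonZero B
    B-nonZero = ℚ.pos⇒nonZero B
  δ = ε ℚ.* 1/ B
  0<δ : 0ℚ ℚ.< δ
  0<δ = ℚ.positive⁻¹ δ {{ℚ.pos*pos⇒pos ε (1/ B) {{ℚ.1/pos⇒pos B}}}}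

Null-∑ : ∀ {m} (x : Fin m → ℕ → ℚ) → (∀ k → Null (x k)) → Null (λ n → ∑ℚ (λ k → x k n))
Null-∑ {ℕ.zero}  x x-null = Null-0
Null-∑ {ℕ.suc m} x x-null = Null-+ (x-null Fin.zero) (Null-∑ (x ∘ Fin.suc) (x-null ∘ Fin.suc))

-- Equality in ℚ is decidable; were `r` nonzero, nullity at `ε = ∣ r ∣` would give `∣ r ∣ < ∣ r ∣`.
Null-const : ∀ {x r} → (∀ n → x n ≡ r) → Null x → r ≡ 0ℚ
Null-const {x} {r} x≡r x-null with r ℚ.≟ 0ℚ
... | yes r≡0 = r≡0
... | no  r≢0 = contradiction
  (subst (λ y → ∣ y ∣ ℚ.< ∣ r ∣) (x≡r N) (proj₂ (x-null ∣ r ∣ 0<∣r∣) N ℕ.≤-refl))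
  (ℚ.<-irrefl refl)
  where
  0<∣r∣ : 0ℚ ℚ.< ∣ r ∣
  0<∣r∣ with ℚ.<-cmp 0ℚ ∣ r ∣
  ... | tri< 0<∣r∣ _ _ = 0<∣r∣
  ... | tri≈ _ 0≡∣r∣ _ = contradiction (ℚ.∣p∣≡0⇒p≡0 r (sym 0≡∣r∣)) r≢0
  ... | tri> _ _ ∣r∣<0 = contradiction (ℚ.<-≤-trans ∣r∣<0 (ℚ.0≤∣p∣ r)) (ℚ.<-irrefl refl)
  N = proj₁ (x-null ∣ r ∣ 0<∣r∣)

-- Passing from real combinations to integer functionals.

seq-∑ℝ : ∀ {q} (f : Vector ℝ q) n → seq (∑ℝ f) n ≡ ∑ℚ (λ k → seq (f k) n)
seq-∑ℝ {ℕ.zero}  f n = refl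
seq-∑ℝ {ℕ.suc q} f n = cong (seq (head f) n ℚ.+_) (seq-∑ℝ (tail f) n)

-- At every index `N` the functional takes the value `r` on the difference of the `N`-th terms. This
-- constant sequence is also a finite sum of null sequences scaled by the `a m`, hence null.
≃-functional-zero : ∀ {n} (x y : Vector ℝ n) (a : Vector ℚ n) {r} → (∀ m → x m ≃ y m) →
  (∀ N → ∑ℚ (λ m → seq (y m) N ℚ.* a m) ≡ 0ℚ) →
  (∀ N → ∑ℚ (λ m → seq (x m) N ℚ.* a m) ≡ r) → r ≡ 0ℚ
≃-functional-zero x y a x≃y y∙a≡0 x∙a≡r = Null-const
  (λ N → trans (subtract-zero (λ m → seq (x m) N) (λ m → seq (y m) N) a (y∙a≡0 N)) (x∙a≡r N))
  (Null-∑ (λ m N → (seq (x m) N ℚ.- seq (y m) N) ℚ.* a m)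
    (λ m → Null-*ʳ {λ N → seq (x m) N ℚ.- seq (y m) N} (x≃y m) (a m)))

zero-on-combination : ∀ {q n} (v : Fin q → Vector ℤ n) (a : Vector ℤ n) →
  (∀ k → ∑ℤ (λ m → v k m ℤ.* a m) ≡ 0ℤ) →
  ∀ (x : Vector ℤ n) (c : Vector ℝ q) → (∀ m → fromℤ (x m) ≃ ∑ℝ (λ k → c k *ℝ fromℤ (v k m))) →
  ∑ℤ (λ m → x m ℤ.* a m) ≡ 0ℤ
zero-on-combination v a v∙a≡0 x c x≃∑cv = ι-injective
  (≃-functional-zero (λ m → fromℤ (x m)) (λ m → ∑ℝ (λ k → c k *ℝ fromℤ (v k m))) (λ m → ι (a m)) x≃∑cv
    -- The `N`-th terms of the real coefficients are rational, so the `N`-th term of the combination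
    -- is a rational combination of the `v k`.
    (λ N → trans
      (∑ℚ.sum-cong-≗ (λ m → cong (ℚ._* ι (a m)) (seq-∑ℝ (λ k → c k *ℝ fromℤ (v k m)) N)))
      (combination-zero (λ k → seq (c k) N) (λ k m → ι (v k m)) (λ m → ι (a m)) ιv∙ιa≡0))
    (λ N → sym (ι-∑ x a)))
  where
  ιv∙ιa≡0 : ∀ k → ∑ℚ (λ m → ι (v k m) ℚ.* ι (a m)) ≡ 0ℚ
  ιv∙ιa≡0 k = trans (sym (ι-∑ (v k) a)) (cong ι (v∙a≡0 k))

-- Sums of nonnegative integers

∑-nonNegative : ∀ {q} (f : Vector ℤ q) → (∀ k → 0ℤ ℤ.≤ f k) → 0ℤ ℤ.≤ ∑ℤ f
∑-nonNegative {ℕ.zero}  f 0≤f = ℤ.≤-refl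
∑-nonNegative {ℕ.suc q} f 0≤f =
  ℤ.+-mono-≤ (0≤f Fin.zero) (∑-nonNegative (tail f) (0≤f ∘ Fin.suc))

term≤∑ : ∀ {q} (f : Vector ℤ q) → (∀ k → 0ℤ ℤ.≤ f k) → ∀ k → f k ℤ.≤ ∑ℤ f
term≤∑ f 0≤f Fin.zero    = ℤ.≤-trans (ℤ.≤-reflexive (sym (ℤ.+-identityʳ (head f))))
  (ℤ.+-monoʳ-≤ (head f) (∑-nonNegative (tail f) (0≤f ∘ Fin.suc)))
term≤∑ f 0≤f (Fin.suc k) = ℤ.≤-trans (ℤ.≤-reflexive (sym (ℤ.+-identityˡ (f (Fin.suc k)))))
  (ℤ.+-mono-≤ (0≤f Fin.zero) (term≤∑ (tail f) (0≤f ∘ Fin.suc) k))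

-- A positive integer weight is at least 1, so each weighted term dominates the unweighted one, and
-- the other terms are nonnegative.
weighted-term≤∑ : ∀ {q} (ω : Fin q → ℕ) (f : Vector ℤ q) →
  (∀ k → 0 ℕ.< ω k) → (∀ k → 0ℤ ℤ.≤ f k) → ∀ k → f k ℤ.≤ ∑ℤ (λ i → + ω i ℤ.* f i)
weighted-term≤∑ ω f 0<ω 0≤f k =
  ℤ.≤-trans (f≤ωf k) (term≤∑ (λ i → + ω i ℤ.* f i) (λ i → ℤ.≤-trans (0≤f i) (f≤ωf i)) k)
  where
  f≤ωf : ∀ i → f i ℤ.≤ + ω i ℤ.* f i
  f≤ωf i = ℤ.≤-trans (ℤ.≤-reflexive (sym (ℤ.*-identityˡ (f i))))
    (ℤ.*-monoʳ-≤-nonNeg (f i) {{nonNegative (0≤f i)}} (+≤+ (0<ω i)))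

-- Positive and negative parts of integers.

positivePart-decomposition : ∀ x → 0ℤ ℤ.⊔ x ≡ x ℤ.+ (0ℤ ℤ.⊔ ℤ.- x)
positivePart-decomposition (+ ℕ.zero)  = refl
positivePart-decomposition (+ ℕ.suc n) = sym (ℤ.+-identityʳ (+ ℕ.suc n))
positivePart-decomposition -[1+ n ]    = sym (ℤ.+-inverseʳ -[1+ n ])

-- The first bound excludes `x ≥ 2`, the second `x ≤ -2`. The left alternative has the form of
-- membership in `gallery`.
parts≤1 : ∀ x → 0ℤ ℤ.⊔ x ℤ.≤ 1ℤ → 0ℤ ℤ.⊔ ℤ.- x ℤ.≤ 1ℤ → ℤ.∣ x ∣ ≡ 1 ⊎ x ≡ 0ℤ
parts≤1 (+ 0)               _ _ = inj₂ refl
parts≤1 (+ 1)               _ _ = inj₁ refl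
parts≤1 (+ ℕ.suc (ℕ.suc n)) (+≤+ (ℕ.s≤s ())) _
parts≤1 -[1+ 0 ]            _ _ = inj₁ refl
parts≤1 -[1+ ℕ.suc n ]      _ (+≤+ (ℕ.s≤s ()))

-- Values of functionals on the rays of a fan.

module _ {n} (F : TropicalFan n) where

  open TropicalFan F

  -- Balancing holds coordinate by coordinate; once `l` is written in coordinates, exchanging the
  -- sums turns the left side into a combination of these relations.
  ∑ωl[v]≡0 : ∀ l → ∑ℤ (λ k → + ω k ℤ.* ⟦ l ⟧ (v k)) ≡ 0ℤ
  ∑ωl[v]≡0 l = begin
    ∑ℤ (λ k → + ω k ℤ.* ⟦ l ⟧ (v k))
      ≡⟨ ∑ℤ.sum-cong-≗ (λ k → cong (+ ω k ℤ.*_) (l≡ (v k))) ⟩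
    ∑ℤ (λ k → + ω k ℤ.* ∑ℤ (λ m → v k m ℤ.* a m))
      ≡⟨ linearCombination-assoc ℤ-semiring (λ k → + ω k) v a ⟨
    ∑ℤ (λ m → ∑ℤ (λ k → + ω k ℤ.* v k m) ℤ.* a m)
      ≡⟨ sum-zero ℤ-semiring _ (λ m → cong (ℤ._* a m) (balanced m)) ⟩
    0ℤ ∎
    where
    open ≡-Reasoning
    a  = proj₁ (additive⇒coordinates ⟦ l ⟧ (Dual-isAdditive l))
    l≡ = proj₂ (additive⇒coordinates ⟦ l ⟧ (Dual-isAdditive l))

  -- Each positive part is the value plus its negative part, and by balancing the values contribute
  -- zero to the weighted sum.
  maxDegree-neg : ∀ l → maxDegree F l ≡ ∑ℤ (λ k → + ω k ℤ.* (0ℤ ℤ.⊔ ℤ.- ⟦ l ⟧ (v k)))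
  maxDegree-neg l = begin
    maxDegree F l
      ≡⟨ ∑ℤ.sum-cong-≗ (λ k → trans (cong (+ ω k ℤ.*_) (positivePart-decomposition (x k)))
                                    (ℤ.*-distribˡ-+ (+ ω k) (x k) (y k))) ⟩
    ∑ℤ (λ k → + ω k ℤ.* x k ℤ.+ + ω k ℤ.* y k)
      ≡⟨ ∑ℤ.∑-distrib-+ (λ k → + ω k ℤ.* x k) (λ k → + ω k ℤ.* y k) ⟩
    ∑ℤ (λ k → + ω k ℤ.* x k) ℤ.+ ∑ℤ (λ k → + ω k ℤ.* y k)
      ≡⟨ cong (λ s → s ℤ.+ ∑ℤ (λ k → + ω k ℤ.* y k)) (∑ωl[v]≡0 l) ⟩
    0ℤ ℤ.+ ∑ℤ (λ k → + ω k ℤ.* y k)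
      ≡⟨ ℤ.+-identityˡ _ ⟩
    ∑ℤ (λ k → + ω k ℤ.* y k) ∎
    where
    open ≡-Reasoning
    x y : Vector ℤ q
    x k = ⟦ l ⟧ (v k)
    y k = 0ℤ ℤ.⊔ ℤ.- ⟦ l ⟧ (v k)

  -- Each term of a positively weighted sum of nonnegative integers with total 1 is at most 1.
  -- Positive parts thus bound the values from above; negative parts, with the same total by
  -- `maxDegree-neg`, bound them from below.
  degree-one⇒unit-or-zero : ∀ l → maxDegree F l ≡ 1ℤ → ∀ k → gallery F l k ⊎ ⟦ l ⟧ (v k) ≡ 0ℤ
  degree-one⇒unit-or-zero l deg≡1 k = parts≤1 (⟦ l ⟧ (v k))
    (part≤1 (λ i → ⟦ l ⟧ (v i)) deg≡1)
    (part≤1 (λ i → ℤ.- ⟦ l ⟧ (v i)) (trans (sym (maxDegree-neg l)) deg≡1))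
    where
    part≤1 : ∀ x → ∑ℤ (λ i → + ω i ℤ.* (0ℤ ℤ.⊔ x i)) ≡ 1ℤ → 0ℤ ℤ.⊔ x k ℤ.≤ 1ℤ
    part≤1 x ∑≡1 = ℤ.≤-trans
      (weighted-term≤∑ ω (λ i → 0ℤ ℤ.⊔ x i) ω-positive (λ i → ℤ.i≤i⊔j 0ℤ (x i)) k)
      (ℤ.≤-reflexive ∑≡1)

  galleries-agree-on-rays : ∀ {l h i j} → IsGallery F l i j → IsGallery F h i j →
                            ∀ k → ⟦ l ⟧ (v k) ≡ ⟦ h ⟧ (v k)
  galleries-agree-on-rays {l} {h} {i} {j} gl gh k =
    decide (degree-one⇒unit-or-zero l L.degree-one k) (degree-one⇒unit-or-zero h H.degree-one k)
    where
    module L = IsGallery gl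
    module H = IsGallery gh
    on-gallery : (｛ i ｝ ∪ ｛ j ｝) k → ⟦ l ⟧ (v k) ≡ ⟦ h ⟧ (v k)
    on-gallery (inj₁ refl) = trans L.l[va]≡1 (sym H.l[va]≡1)
    on-gallery (inj₂ refl) = trans L.l[vb]≡-1 (sym H.l[vb]≡-1)
    decide : gallery F l k ⊎ ⟦ l ⟧ (v k) ≡ 0ℤ → gallery F h k ⊎ ⟦ h ⟧ (v k) ≡ 0ℤ →
             ⟦ l ⟧ (v k) ≡ ⟦ h ⟧ (v k)
    -- Membership in either gallery alone makes `k` equal to `i` or `j`, where both values are
    -- prescribed; the mixed case therefore closes without a contradiction.
    decide (inj₁ k∈l) _          = on-gallery (proj₁ L.rays k∈l)
    decide (inj₂ _)   (inj₁ k∈h) = on-gallery (proj₁ H.rays k∈h)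
    decide (inj₂ l≡0) (inj₂ h≡0) = trans l≡0 (sym h≡0)

  zero-on-rays⇒zero : RaysSpan F → (a : Vector ℤ n) → (∀ k → ∑ℤ (λ m → v k m ℤ.* a m) ≡ 0ℤ) →
                      ∀ x → ∑ℤ (λ m → x m ℤ.* a m) ≡ 0ℤ
  zero-on-rays⇒zero span a v∙a≡0 x = zero-on-combination v a v∙a≡0 x
    (proj₁ (span (λ m → fromℤ (x m)))) (proj₂ (span (λ m → fromℤ (x m))))

lemma3p10 : ∀ {n : ℕ} (F : TropicalFan n) → RaysSpan F → ∀ (i j : Fin (TropicalFan.q F)) (l h : Dual n) → IsGallery F l i j → IsGallery F h i j → l ≈ᵈ h
lemma3p10 F span i j l h gl gh x = ℤ.i-j≡0⇒i≡j (⟦ l ⟧ x) (⟦ h ⟧ x) (trans (l-h≡ x)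
  (zero-on-rays⇒zero F span a
    (λ k → trans (sym (l-h≡ (v k))) (ℤ.i≡j⇒i-j≡0 (galleries-agree-on-rays F gl gh k))) x))
  where
  open TropicalFan F
  -- Coordinates are taken for the difference, so that agreement on the rays becomes a single
  -- functional vanishing on every `v k`.
  coordinates = additive⇒coordinates (λ y → ⟦ l ⟧ y ℤ.- ⟦ h ⟧ y)
    (difference-isAdditive (Dual-isAdditive l) (Dual-isAdditive h))
  a    = proj₁ coordinates
  l-h≡ = proj₂ coordinates
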